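{- Let $G$ be a finite simple graph with at least two vertices and without isolated vertex. Then $\mathcal{M}_G$ defines a map on all finite simple graphs which counts occurrences of $G$ as a subgraph: for every finite simple graph $H$, the value $\mathcal{M}_G(H)$ is well defined (independent of the labeling of $H$ chosen to compute it) and equals the number of subgraphs of $H$ (not necessarily induced) that are isomorphic to $G$.
   Context: Graphs are finite, undirected, without loops or multiple edges. Let $x_{ij}$, for integers $0<i<j$, be commuting variables; infinite formal sums of monomials in them are allowed. Action: for $\sigma \in \mathfrak{S}_n$ and $1\le i<j\le n$, $\sigma\cdot(i,j) := (\min(\sigma(i),\sigma(j)),\max(\sigma(i),\sigma(j)))$. Definition of $\mathcal{M}_G$: let $G$ be a graph on $n\ge 2$ vertices without isolated vertex. Choose any labeling of the vertices of $G$ by $1,\dots,n$ and let $a_{ij}\in\{0,1\}$ ($1\le i<j\le n$) be $1$ if and only if $i$ and $j$ are adjacent. Let $R\subset\mathfrak{S}_n$ be a set of permutations such that the families $(a_{\sigma\cdot(i,j)})_{1\le i<j\le n}$, $\sigma\in R$, are pairwise distinct and exhaust all the families obtained for $\sigma\in\mathfrak{S}_n$. Then $$\mathcal{M}_G := \sum_{0<r_1<\dots<r_n}\ \sum_{\sigma\in R}\ \prod_{1\le i<j\le n} x_{r_i r_j}^{a_{\sigma\cdot(i,j)}} .$$ Evaluation: for a finite graph $H$ on $N$ vertices, choose a labeling of its vertices by $1,\dots,N$; put $b_{ij}=1$ if $i<j\le N$ and $i,j$ are adjacent in $H$, and $b_{ij}=0$ for all other pairs $i<j$ (in particular whenever $j>N$).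 Then $\mathcal{M}_G(H)$ is obtained by substituting $x_{ij}=b_{ij}$ in $\mathcal{M}_G$; only finitely many monomials give a nonzero value. A subgraph of $H$ isomorphic to $G$ is a pair (vertex subset, edge subset) of $H$ forming a graph isomorphic to $G$; thus occurrences are counted up to automorphisms of $G$ (e.g. $\mathcal{M}_G(G)=1$). -}

module Defs where

open import Algebra.Construct.NaturalChoice.Max using () renaming (_⊔_ to maximum)
open import Algebra.Construct.NaturalChoice.Min using () renaming (_⊓_ to minimum)
open import Data.Bool.Base using (Bool; true; false; T; if_then_else_)
open import Data.Fin.Base as Fin using (Fin; fromℕ<)
open import Data.Fin.Permutation using (Permutation′; _⟨$⟩ʳ_)
import Data.Fin.Properties as Fin
open import Data.List.Base using (List; length; lookup; map; filter; allFin; cartesianProduct)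
open import Data.List.Membership.Propositional using (_∈_)
open import Data.List.Relation.Unary.AllPairs using (AllPairs)
open import Data.List.Relation.Unary.Any using (Any)
open import Data.List.Relation.Unary.Unique.Propositional using (Unique)
open import Data.Nat.Base using (ℕ; zero; suc; _<_; _^_)
open import Data.Nat.ListAction using (sum; product)
open import Data.Nat.Properties using (_<?_; <-trans)
open import Data.Product.Base using (Σ; ∃; _×_; _,_; proj₁; proj₂)
open import Data.Vec.Base as Vec using (Vec; _∷_)
open import Data.Vec.Relation.Unary.Linked using (Linked)
open import Function.Base using (_∘_)
open import Function.Bundles using (Inverse; _↔_)
open import Level using (0ℓ)
open import Relation.Binary.Bundles using (Setoid)
open import Relation.Binary.PropositionalEquality using (_≡_; _≢_; refl; sym; trans; setoid)
open import Relation.Nullary.Decidable using (yes; no)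
open import Relation.Nullary.Negation using (¬_)

record Graph : Set₁ where
  field
    Vertex      : Set
    adjacent    : Vertex → Vertex → Bool
    symmetric   : ∀ u v → adjacent u v ≡ adjacent v u
    irreflexive : ∀ v → adjacent v v ≡ false

record FiniteGraph : Set₁ where
  field
    graph  : Graph
    order  : ℕ
    finite : Graph.Vertex graph ↔ Fin order
  open Graph graph public

open FiniteGraph using (graph; order; Vertex; adjacent)

NoIsolatedVertex : FiniteGraph → Set
NoIsolatedVertex G = ∀ (v : Vertex G) → ∃ λ w → T (adjacent G v w)

-- The element i of Fin n stands for the label i + 1 of {1, …, n}.
Labeling : FiniteGraph → Set
Labeling G = Vertex G ↔ Fin (order G)

record _≅_ (G H : Graph) : Set where
  private
    module G = Graph G
    module H = Graph H
  field
    bijection : G.Vertex ↔ H.Vertex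
    preserves : ∀ u v → G.adjacent u v ≡
                        H.adjacent (Inverse.to bijection u) (Inverse.to bijection v)

-- A set of edges is given by the characteristic function of the
-- symmetric relation "u and v are joined by an edge of the set".
record Subgraph (H : Graph) : Set where
  private module H = Graph H
  field
    vertices  : H.Vertex → Bool
    edges     : H.Vertex → H.Vertex → Bool
    symmetric : ∀ u v → edges u v ≡ edges v u
    edges⊆    : ∀ {u v} → T (edges u v) → T (H.adjacent u v)
    endpoints : ∀ {u v} → T (edges u v) → T (vertices u) × T (vertices v)

open Subgraph using (vertices; edges)

private
  antireflexive : ∀ {a b} → (T a → T b) → b ≡ false → a ≡ false
  antireflexive {false} _ _    = refl
  antireflexive {true}  f refl with () ← f _

toGraph : ∀ {H} → Subgraph H → Graph
toGraph {H} S = record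
  { Vertex      = Σ (Graph.Vertex H) (T ∘ vertices S)
  ; adjacent    = λ u v → edges S (proj₁ u) (proj₁ v)
  ; symmetric   = λ u v → Subgraph.symmetric S (proj₁ u) (proj₁ v)
  ; irreflexive = λ v → antireflexive (Subgraph.edges⊆ S) (Graph.irreflexive H (proj₁ v))
  }

-- Two occurrences are equal as soon as they have the same vertex set and
-- the same edge set: the isomorphism with G is not part of the data.
Occurrences : Graph → Graph → Setoid 0ℓ 0ℓ
Occurrences G H = record
  { Carrier       = Σ (Subgraph H) λ S → toGraph S ≅ G
  ; _≈_           = λ (S , _) (S′ , _) →
                      (∀ v → vertices S v ≡ vertices S′ v) ×
                      (∀ u v → edges S u v ≡ edges S′ u v)
  ; isEquivalence = record
    { refl  = (λ _ → refl) , (λ _ _ → refl)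
    ; sym   = λ (p , q) → (λ v → sym (p v)) , (λ u v → sym (q u v))
    ; trans = λ (p , q) (p′ , q′) → (λ v → trans (p v) (p′ v)) , (λ u v → trans (q u v) (q′ u v))
    }
  }

HasCardinality : Setoid 0ℓ 0ℓ → ℕ → Set
HasCardinality S k = Inverse S (setoid (Fin k))

-- (i , j) is the variable x_{ij}. Only pairs with 0 < i < j are used.
Variable : Set
Variable = ℕ × ℕ

-- The product of the powers x ^ e over the entries (x , e).
Monomial : Set
Monomial = List (Variable × ℕ)

-- A possibly infinite sum, as the family of its terms.
record FormalSum : Set₁ where
  field
    Index : Set
    term  : Index → Monomial

evaluate : (Variable → ℕ) → Monomial → ℕ
evaluate b m = product (map (λ (x , e) → b x ^ e) m)

-- Only finitely many values of f are non-zero, and they add up to s.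
HasFiniteSum : {A : Set} → (A → ℕ) → ℕ → Set
HasFiniteSum {A} f s = ∃ λ (xs : List A) →
  Unique xs × (∀ a → f a ≢ 0 → a ∈ xs) × sum (map f xs) ≡ s

_at_evaluatesTo_ : FormalSum → (Variable → ℕ) → ℕ → Set
M at b evaluatesTo s = HasFiniteSum (evaluate b ∘ FormalSum.term M) s

infix 8 _·_

_·_ : ∀ {n} → Permutation′ n → Fin n × Fin n → Fin n × Fin n
_·_ {n} σ (i , j) =
  minimum (Fin.≤-totalOrder n) (σ ⟨$⟩ʳ i) (σ ⟨$⟩ʳ j) ,
  maximum (Fin.≤-totalOrder n) (σ ⟨$⟩ʳ i) (σ ⟨$⟩ʳ j)

orderedPairs : ∀ n → List (Fin n × Fin n)
orderedPairs n = filter (λ (i , j) → i Fin.<? j) (cartesianProduct (allFin n) (allFin n))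

indicator : Bool → ℕ
indicator p = if p then 1 else 0

module _ (G : FiniteGraph) (ℓ : Labeling G) where

  private
    n = order G

  coefficient : Fin n × Fin n → ℕ
  coefficient (i , j) = indicator (adjacent G (Inverse.from ℓ i) (Inverse.from ℓ j))

  SameFamily : Permutation′ n → Permutation′ n → Set
  SameFamily σ τ = ∀ i j → i Fin.< j → coefficient (σ · (i , j)) ≡ coefficient (τ · (i , j))

  IsTransversal : List (Permutation′ n) → Set
  IsTransversal R = AllPairs (λ σ τ → ¬ SameFamily σ τ) R × (∀ σ → Any (SameFamily σ) R)

-- 0 < r₁ < ⋯ < rₙ. The proof is irrelevant, so that tuples with the same
-- entries are equal.
record IncreasingTuple (n : ℕ) : Set where
  field
    entries     : Vec ℕ n
    .increasing : Linked _<_ (0 ∷ entries)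

-- The permutations of R are indexed by their positions in the list.
𝓜 : (G : FiniteGraph) → Labeling G → List (Permutation′ (order G)) → FormalSum
𝓜 G ℓ R = record
  { Index = IncreasingTuple (order G) × Fin (length R)
  ; term  = λ (r , p) → let r′ = Vec.lookup (IncreasingTuple.entries r); σ = lookup R p in
      map (λ (i , j) → ((r′ i , r′ j) , coefficient G ℓ (σ · (i , j))))
          (orderedPairs (order G))
  }

-- x_{ij} ↦ b_{ij}. The label i + 1 is carried by the vertex at position i.
substitution : (H : FiniteGraph) → Labeling H → Variable → ℕ
substitution H ℓ (suc i , suc j) with i <? j | j <? order H
... | yes i<j | yes j<N = coefficient H ℓ (fromℕ< (<-trans i<j j<N) , fromℕ< j<N)
... | _       | _       = 0
substitution H ℓ _ = 0

{-# OPTIONS --safe #-}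

-- Substituting the adjacency of H turns each monomial of 𝓜 into 0 or 1. As G
-- has no isolated vertex, a monomial with value 1 has only labels of vertices
-- of H among r₁ < ⋯ < rₙ, so it encodes a copy of G in H: the vertex set is
-- read off the rᵢ, the edge set off the variables with exponent 1. Conversely
-- a copy of G determines the rᵢ by sorting its labels, and then the family of
-- exponents, which R represents exactly once. So for each labeling of H the
-- value is the number of copies of G, which does not mention the labeling.

module Submission where

import Algebra.Construct.NaturalChoice.Max as Max
import Algebra.Construct.NaturalChoice.Min as Min
open import Data.Bool.Base using (Bool; true; false; T)
open import Data.Bool.Properties using (T?; T-irrelevant)
open import Data.Fin.Base as Fin using (Fin; zero; suc; toℕ; fromℕ<)
open import Data.Fin.Permutation using (Permutation′; _⟨$⟩ʳ_; _⟨$⟩ˡ_; ↔⇒≡; inverseʳ)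
import Data.Fin.Properties as Fin
open import Data.List.Base using (List; []; _∷_; length; lookup; map; filter; allFin;
  cartesianProduct; cartesianProductWith; deduplicate; mapMaybe; upTo)
open import Data.List.Membership.Propositional using (_∈_)
open import Data.List.Membership.Propositional.Properties using (∈-lookup; ∈-filter⁺; ∈-filter⁻;
  ∈-allFin; ∈-map⁺; ∈-cartesianProduct⁺; ∈-cartesianProductWith⁺; ∈-deduplicate⁺; ∈-upTo⁺)
open import Data.List.Relation.Unary.All as All using (All; []; _∷_)
import Data.List.Relation.Unary.All.Properties as All
open import Data.List.Relation.Unary.AllPairs using (AllPairs; []; _∷_)
import Data.List.Relation.Unary.AllPairs.Properties as AllPairs
open import Data.List.Relation.Unary.Any as Any using (here; index)
open import Data.List.Relation.Unary.Any.Properties using (lookup-index; mapMaybe⁺)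
import Data.List.Relation.Unary.Unique.Propositional.Properties as Unique
open import Data.List.Relation.Unary.Unique.DecPropositional.Properties using (deduplicate-!)
open import Data.Maybe.Base using (Maybe; just; nothing)
import Data.Maybe.Relation.Unary.Any as Maybe
open import Data.Nat.Base using (ℕ; zero; suc; _+_; _*_; z≤n; s≤s; _≤_; _<_; _^_)
open import Data.Nat.ListAction using (sum)
import Data.Nat.Properties as ℕ
open import Data.Product.Base using (Σ; ∃; _×_; _,_; proj₁; proj₂)
open import Data.Product.Properties using (×-≡,≡→≡; Σ-≡,≡→≡) renaming (≡-dec to ×-≡-dec)
open import Data.Sum.Base using ([_,_]′)
open import Data.Vec.Base as Vec using (Vec; []; _∷_)
import Data.Vec.Properties as Vec
open import Data.Vec.Relation.Unary.Linked using (Linked; [-]; _∷_; linked?)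
import Data.Vec.Relation.Unary.Linked.Properties as Linked
open import Function.Base using (_∘_; id)
open import Function.Bundles using (Inverse; _↔_; mk↔ₛ′)
open import Function.Construct.Composition using (_↔-∘_)
import Function.Construct.Composition as Composition
import Function.Construct.Symmetry as Symmetry
open import Level using (0ℓ)
open import Relation.Binary.Bundles using (Setoid)
open import Relation.Binary.Definitions using (DecidableEquality; tri<; tri≈; tri>)
open import Relation.Binary.PropositionalEquality using (_≡_; _≢_; refl; sym; trans; cong; cong₂;
  subst)
open import Relation.Nullary.Decidable using (Dec; yes; no; ¬?; ⌊_⌋; toWitness; fromWitness;
  map′; _×-dec_; recompute)
open import Relation.Nullary.Negation using (¬_; contradiction)
open import Defs

open FiniteGraph using (graph; order; Vertex; adjacent)
open Subgraph using (vertices; edges; edges⊆; endpoints)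

-- Booleans, indicators, and finite counting along a relation.

T-extensional : ∀ {a b} → (T a → T b) → (T b → T a) → a ≡ b
T-extensional {false} {false} _ _ = refl
T-extensional {true}  {true}  _ _ = refl
T-extensional {false} {true}  _ g with () ← g _
T-extensional {true}  {false} f _ with () ← f _

indicator-injective : ∀ {a b} → indicator a ≡ indicator b → a ≡ b
indicator-injective {false} {false} _ = refl
indicator-injective {true}  {true}  _ = refl

indicator≤1 : ∀ a → indicator a ≤ 1
indicator≤1 false = z≤n
indicator≤1 true  = s≤s z≤n

T⇒indicator≢0 : ∀ {a} → T a → indicator a ≢ 0
T⇒indicator≢0 {true} _ ()

indicator≢0⇒T : ∀ {a} → indicator a ≢ 0 → T a
indicator≢0⇒T {false} ≢0 = ≢0 refl
indicator≢0⇒T {true}  _  = _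

to-injective : ∀ {A B : Set} (f : A ↔ B) {x y} → Inverse.to f x ≡ Inverse.to f y → x ≡ y
to-injective f {x} {y} eq =
  trans (sym (Inverse.strictlyInverseʳ f x))
        (trans (cong (Inverse.from f) eq) (Inverse.strictlyInverseʳ f y))

AllPairs-lookup : ∀ {A : Set} {R : A → A → Set} {xs} → AllPairs R xs →
                  ∀ {i j} → i Fin.< j → R (lookup xs i) (lookup xs j)
AllPairs-lookup {xs = _ ∷ xs} (rx ∷ _)   {zero}  {suc j} _         = All.lookup rx (∈-lookup j)
AllPairs-lookup               (_ ∷ rxs)  {suc i} {suc j} (s≤s i<j) = AllPairs-lookup rxs i<j

-- Of two distinct positions one comes first, and symmetry of `R` covers both orders. With equality
-- this treats lists without repetition, with `SameFamily` the transversal.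
AllPairs-¬⇒≡ : ∀ {A : Set} {R : A → A → Set} → (∀ {x y} → R x y → R y x) →
               ∀ {xs} → AllPairs (λ x y → ¬ R x y) xs →
               ∀ {i j} → R (lookup xs i) (lookup xs j) → i ≡ j
AllPairs-¬⇒≡ R-sym ¬rxs {i} {j} r with Fin.<-cmp i j
... | tri< i<j _ _ = contradiction r (AllPairs-lookup ¬rxs i<j)
... | tri≈ _ i≡j _ = i≡j
... | tri> _ _ j<i = contradiction (R-sym r) (AllPairs-lookup ¬rxs j<i)

sum-map-≡1 : ∀ {A : Set} {f : A → ℕ} {xs} → All (λ x → f x ≡ 1) xs → sum (map f xs) ≡ length xs
sum-map-≡1 []           = refl
sum-map-≡1 (fx≡1 ∷ fxs) = cong₂ _+_ fx≡1 (sum-map-≡1 fxs)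

-- The relation `_~_` matches the support of `f` with the classes of `S`, and a function with values
-- 0 and 1 sums to the size of its support. With a relation in place of a function, respect for `≈`
-- follows from injectivity.
count : ∀ {A : Set} → DecidableEquality A → (S : Setoid 0ℓ 0ℓ) → let open Setoid S in
        (f : A → ℕ) → (∀ a → f a ≤ 1) →
        (xs : List A) → (∀ a → f a ≢ 0 → a ∈ xs) →
        (_~_ : A → Carrier → Set) →
        (∀ a → f a ≢ 0 → ∃ λ s → a ~ s) →
        (∀ s → ∃ λ a → f a ≢ 0 × a ~ s) →
        (∀ {a a′ s s′} → s ≈ s′ → a ~ s → a′ ~ s′ → a ≡ a′) →
        (∀ {a s s′} → a ~ s → a ~ s′ → s ≈ s′) →
        ∃ λ k → HasFiniteSum f k × HasCardinality S k
count {A} _≟_ S f f≤1 xs support⊆xs _~_ total surjective injective univalent =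
  length ys ,
  (ys , ys-unique , support⊆ys , sum-map-≡1 (All.tabulate λ a∈ys → ≢0⇒≡1 (f≤1 _) (ys⊆support a∈ys))) ,
  record
    { to        = position
    ; from      = λ i → proj₁ (related i)
    ; to-cong   = λ {s} {s′} s≈s′ →
        lookup-injective (injective s≈s′ (lookup-position s) (lookup-position s′))
    ; from-cong = λ { refl → Setoid.refl S }
    ; inverse   =
        (λ {i} {s} s≈ → lookup-injective (injective s≈ (lookup-position s) (proj₂ (related i)))) ,
        (λ {s} {i} i≡ → univalent (proj₂ (related i))
           (subst (λ j → lookup ys j ~ s) (sym i≡) (lookup-position s)))
    }
  where
  open Setoid S using (Carrier)

  ≢0⇒≡1 : ∀ {m} → m ≤ 1 → m ≢ 0 → m ≡ 1
  ≢0⇒≡1 z≤n       ≢0 = contradiction refl ≢0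
  ≢0⇒≡1 (s≤s z≤n) _  = refl

  nonzero? : ∀ a → Dec (f a ≢ 0)
  nonzero? a = ¬? (f a ℕ.≟ 0)

  -- Repetitions and zeros are removed from `xs`, so that the sum of `f` over `ys` is its length and
  -- positions in `ys` number the classes of `S`.
  ys = filter nonzero? (deduplicate _≟_ xs)

  ys-unique = Unique.filter⁺ nonzero? (deduplicate-! _≟_ xs)

  support⊆ys : ∀ a → f a ≢ 0 → a ∈ ys
  support⊆ys a ≢0 = ∈-filter⁺ nonzero? (∈-deduplicate⁺ _≟_ (support⊆xs a ≢0)) ≢0

  ys⊆support : ∀ {a} → a ∈ ys → f a ≢ 0
  ys⊆support a∈ys = proj₂ (∈-filter⁻ nonzero? {xs = deduplicate _≟_ xs} a∈ys)

  lookup-injective : ∀ {i j} → lookup ys i ≡ lookup ys j → i ≡ j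
  lookup-injective = AllPairs-¬⇒≡ sym ys-unique

  related : ∀ i → ∃ λ s → lookup ys i ~ s
  related i = total _ (ys⊆support (∈-lookup i))

  position : Carrier → Fin (length ys)
  position s = index (support⊆ys _ (proj₁ (proj₂ (surjective s))))

  lookup-position : ∀ s → lookup ys (position s) ~ s
  lookup-position s = let a , ≢0 , a~s = surjective s in
    subst (_~ s) (lookup-index (support⊆ys a ≢0)) a~s

-- Composing the two numberings gives a bijection of `Fin k` with `Fin l`. This makes the value
-- independent of the labeling of `H`.
cardinality-unique : ∀ {S k l} → HasCardinality S k → HasCardinality S l → k ≡ l
cardinality-unique f g = ↔⇒≡ (Composition.inverse (Symmetry.inverse f) g)

-- Values of monomials factor by factor.

evaluate≤1 : ∀ {b m} → All (λ (x , e) → b x ^ e ≤ 1) m → evaluate b m ≤ 1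
evaluate≤1 []           = s≤s z≤n
evaluate≤1 (≤1 ∷ all≤1) = ℕ.*-mono-≤ ≤1 (evaluate≤1 all≤1)

evaluate≢0⁺ : ∀ {b m} → All (λ (x , e) → b x ^ e ≢ 0) m → evaluate b m ≢ 0
evaluate≢0⁺ []           ()
evaluate≢0⁺ (≢0 ∷ all≢0) ≡0 = [ ≢0 , evaluate≢0⁺ all≢0 ]′ (ℕ.m*n≡0⇒m≡0∨n≡0 _ ≡0)

evaluate≢0⁻ : ∀ {b m} → evaluate b m ≢ 0 → All (λ (x , e) → b x ^ e ≢ 0) m
evaluate≢0⁻         {m = []}          _  = []
evaluate≢0⁻ {b = b} {m = (x , e) ∷ m} ≢0 =
  (λ ≡0 → ≢0 (cong (_* evaluate b m) ≡0)) ∷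
  evaluate≢0⁻ λ ≡0 → ≢0 (trans (cong (b x ^ e *_) ≡0) (ℕ.*-zeroʳ (b x ^ e)))

-- Increasing tuples and sorted enumerations.

open IncreasingTuple using (entries)

entry : ∀ {n} → IncreasingTuple n → Fin n → ℕ
entry r = Vec.lookup (entries r)

-- The stored proof is irrelevant; since the property is decidable, a usable proof can be
-- recomputed.
increasing : ∀ {n} (r : IncreasingTuple n) → Linked _<_ (0 ∷ entries r)
increasing record { increasing = l } = recompute (linked? ℕ._<?_ _) l

entry-mono : ∀ {n} (r : IncreasingTuple n) {i j} → i Fin.< j → entry r i < entry r j
-- Positions shift by one because the linked vector starts with the extra 0.
entry-mono r {i} {j} i<j = Linked.lookup⁺ ℕ.<-trans {i = suc i} {j = suc j} (increasing r) (s≤s i<j)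

entry-injective : ∀ {n} (r : IncreasingTuple n) {i j} → entry r i ≡ entry r j → i ≡ j
entry-injective r {i} {j} eq with Fin.<-cmp i j
... | tri< i<j _ _ = contradiction eq (ℕ.<⇒≢ (entry-mono r i<j))
... | tri≈ _ i≡j _ = i≡j
... | tri> _ _ j<i = contradiction (sym eq) (ℕ.<⇒≢ (entry-mono r j<i))

entries-injective : ∀ {n} {r s : IncreasingTuple n} → entries r ≡ entries s → r ≡ s
entries-injective refl = refl

_≟-tuple_ : ∀ {n} → DecidableEquality (IncreasingTuple n)
r ≟-tuple s = map′ entries-injective (cong entries) (Vec.≡-dec ℕ._≟_ (entries r) (entries s))

tail : ∀ {m n} {v : Vec ℕ n} {x} → Linked _<_ (m ∷ x ∷ v) → Linked _<_ (x ∷ v)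
tail (_ ∷ l) = l

head< : ∀ {n x} {v : Vec ℕ n} → Linked _<_ (x ∷ v) → ∀ i → x < Vec.lookup v i
head< l i = Linked.lookup⁺ ℕ.<-trans {i = zero} {j = suc i} l (s≤s z≤n)

-- Both heads are the minimum of the common set of entries, hence equal; removing them leaves tails
-- with a common set of entries. The bounds `a` and `b` are separate because they become the heads
-- `x` and `y` in the recursion.
increasing-extensional : ∀ {n a b} {v w : Vec ℕ n} → Linked _<_ (a ∷ v) → Linked _<_ (b ∷ w) →
  (∀ i → ∃ λ j → Vec.lookup v i ≡ Vec.lookup w j) →
  (∀ i → ∃ λ j → Vec.lookup w i ≡ Vec.lookup v j) → v ≡ w
increasing-extensional {v = []}    {[]}    _  _  _   _   = refl
increasing-extensional {v = x ∷ v} {y ∷ w} lv lw v⊆w w⊆v =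
  cong₂ _∷_ x≡y
    (increasing-extensional (tail lv) (tail lw)
      (shrink (tail lv) x≡y v⊆w) (shrink (tail lw) (sym x≡y) w⊆v))
  where
  head≤ : ∀ {n x} {v : Vec ℕ n} → Linked _<_ (x ∷ v) → ∀ i → x ≤ Vec.lookup (x ∷ v) i
  head≤ l zero    = ℕ.≤-refl
  head≤ l (suc i) = ℕ.<⇒≤ (head< l i)

  x≡y : x ≡ y
  x≡y with v⊆w zero | w⊆v zero
  ... | i , x≡wᵢ | j , y≡vⱼ = ℕ.≤-antisym
    (subst (x ≤_) (sym y≡vⱼ) (head≤ (tail lv) j)) (subst (y ≤_) (sym x≡wᵢ) (head≤ (tail lw) i))

  shrink : ∀ {n x y} {v w : Vec ℕ n} → Linked _<_ (x ∷ v) → x ≡ y →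
           (∀ i → ∃ λ j → Vec.lookup (x ∷ v) i ≡ Vec.lookup (y ∷ w) j) →
           ∀ i → ∃ λ j → Vec.lookup v i ≡ Vec.lookup w j
  shrink l x≡y ⊆ i with ⊆ (suc i)
  -- An entry of the tail cannot match the head, which is strictly smaller.
  ... | zero  , vᵢ≡y = contradiction (trans x≡y (sym vᵢ≡y)) (ℕ.<⇒≢ (head< l i))
  ... | suc j , eq   = j , eq

tuple-extensional : ∀ {n} {r s : IncreasingTuple n} →
  (∀ i → ∃ λ j → entry r i ≡ entry s j) → (∀ i → ∃ λ j → entry s i ≡ entry r j) → r ≡ s
tuple-extensional {r = r} {s} r⊆s s⊆r =
  entries-injective (increasing-extensional (increasing r) (increasing s) r⊆s s⊆r)

tabulate-linked : ∀ {n a} {g : Fin n → ℕ} → (∀ i → a < g i) →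
                  (∀ {i j} → i Fin.< j → g i < g j) → Linked _<_ (a ∷ Vec.tabulate g)
tabulate-linked {zero}  a<g g-mono = [-]
tabulate-linked {suc n} a<g g-mono =
  a<g zero ∷ tabulate-linked (λ i → g-mono (s≤s z≤n)) (λ i<j → g-mono (s≤s i<j))

tabulateTuple : ∀ {n} (g : Fin n → ℕ) → (∀ i → 0 < g i) →
                (∀ {i j} → i Fin.< j → g i < g j) → IncreasingTuple n
tabulateTuple g 0<g g-mono = record
  { entries = Vec.tabulate g ; increasing = tabulate-linked 0<g g-mono }

vectors : ∀ {A : Set} → List A → ∀ n → List (Vec A n)
vectors xs zero    = [] ∷ []
vectors xs (suc n) = cartesianProductWith _∷_ xs (vectors xs n)

∈-vectors : ∀ {A : Set} {xs : List A} {n} (v : Vec A n) → (∀ i → Vec.lookup v i ∈ xs) → v ∈ vectors xs n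
∈-vectors []      _   = here refl
∈-vectors (x ∷ v) v⊆ = ∈-cartesianProductWith⁺ _∷_ (v⊆ zero) (∈-vectors v (v⊆ ∘ suc))

toTuple : ∀ {n} → Vec ℕ n → Maybe (IncreasingTuple n)
toTuple v with linked? ℕ._<?_ (0 ∷ v)
... | yes l = just (record { entries = v ; increasing = l })
... | no _  = nothing

-- A finite search range for the support. The bound `suc N` is there because `upTo` excludes its
-- argument, while the label `N` does occur.
boundedTuples : ∀ N n → List (IncreasingTuple n)
boundedTuples N n = mapMaybe toTuple (vectors (upTo (suc N)) n)

∈-boundedTuples : ∀ {N n} (r : IncreasingTuple n) → (∀ i → entry r i ≤ N) → r ∈ boundedTuples N n
∈-boundedTuples {N} {n} r r≤N = mapMaybe⁺ toTuple (vectors (upTo (suc N)) n)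
  (Any.map (λ eq → subst (Maybe.Any (r ≡_)) eq toTuple-entries)
    (∈-map⁺ toTuple (∈-vectors (entries r) λ i → ∈-upTo⁺ (s≤s (r≤N i)))))
  where
  toTuple-entries : Maybe.Any (r ≡_) (toTuple (entries r))
  toTuple-entries with linked? ℕ._<?_ (0 ∷ entries r)
  ... | yes _ = Maybe.just refl
  ... | no ¬l = contradiction (increasing r) ¬l

-- Listing the elements in the order of their labels and filtering by `P` keeps that order. Applied
-- to the vertex set of a copy, this produces the increasing labels.
sortedEnumeration : ∀ {A : Set} {N} (ℓ : A ↔ Fin N) (P : A → Bool) →
  ∃ λ m → ∃ λ (enum : Fin m ↔ Σ A (T ∘ P)) → ∀ {i j} → i Fin.< j →
    Inverse.to ℓ (proj₁ (Inverse.to enum i)) Fin.< Inverse.to ℓ (proj₁ (Inverse.to enum j))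
sortedEnumeration {A} {N} ℓ P = length xs , mk↔ₛ′ to from to∘from from∘to , mono
  where
  open Inverse ℓ using () renaming (to to rank; from to unrank)

  all = map unrank (allFin N)
  xs  = filter (T? ∘ P) all

  mono : ∀ {i j} → i Fin.< j → rank (lookup xs i) Fin.< rank (lookup xs j)
  mono = AllPairs-lookup {R = λ a b → rank a Fin.< rank b}
    (AllPairs.filter⁺ (T? ∘ P) (AllPairs.map⁺ (AllPairs.tabulate⁺-<
    λ {i} {j} → subst id (sym (cong₂ Fin._<_
      (Inverse.strictlyInverseˡ ℓ i) (Inverse.strictlyInverseˡ ℓ j))))))

  to : Fin (length xs) → Σ A (T ∘ P)
  to i = lookup xs i , proj₂ (∈-filter⁻ (T? ∘ P) {xs = all} (∈-lookup i))

  listed : ∀ a → T (P a) → a ∈ xs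
  listed a Pa = ∈-filter⁺ (T? ∘ P)
    (subst (_∈ all) (Inverse.strictlyInverseʳ ℓ a) (∈-map⁺ unrank (∈-allFin (rank a)))) Pa

  from : Σ A (T ∘ P) → Fin (length xs)
  from (a , Pa) = index (listed a Pa)

  to∘from : ∀ s → to (from s) ≡ s
  to∘from (a , Pa) = Σ-≡,≡→≡ (sym (lookup-index (listed a Pa)) , T-irrelevant _ _)

  lookup-injective : ∀ {i j} → lookup xs i ≡ lookup xs j → i ≡ j
  lookup-injective {i} {j} eq with Fin.<-cmp i j
  ... | tri< i<j _ _ = contradiction (cong rank eq) (Fin.<⇒≢ (mono i<j))
  ... | tri≈ _ i≡j _ = i≡j
  ... | tri> _ _ j<i = contradiction (cong rank (sym eq)) (Fin.<⇒≢ (mono j<i))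

  from∘to : ∀ i → from (to i) ≡ i
  from∘to i = lookup-injective (cong proj₁ (to∘from (to i)))

-- Powers with exponent 0 or 1, and the pairs of positions in a monomial.

power≤1 : ∀ {b} e → b ≤ 1 → b ^ e ≤ 1
power≤1 {b} e b≤1 = subst (b ^ e ≤_) (ℕ.^-zeroˡ e) (ℕ.^-monoˡ-≤ e b≤1)

-- Since `b ^ 0` is 1 even for `b` equal to 0, only the exponent 1 constrains `b`.
power≢0⁺ : ∀ {b} e → (T e → b ≢ 0) → b ^ indicator e ≢ 0
power≢0⁺ false _   ()
power≢0⁺ true  b≢0 = subst (_≢ 0) (sym (ℕ.*-identityʳ _)) (b≢0 _)

power≢0⁻ : ∀ {b} e → b ^ indicator e ≢ 0 → T e → b ≢ 0
power≢0⁻ true ≢0 _ = subst (_≢ 0) (ℕ.*-identityʳ _) ≢0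

∈-orderedPairs : ∀ {n} {i j : Fin n} → i Fin.< j → (i , j) ∈ orderedPairs n
∈-orderedPairs {i = i} {j} i<j =
  ∈-filter⁺ (λ (i , j) → i Fin.<? j) (∈-cartesianProduct⁺ (∈-allFin i) (∈-allFin j)) i<j

∈-orderedPairs⇒< : ∀ {n} {i j : Fin n} → (i , j) ∈ orderedPairs n → i Fin.< j
∈-orderedPairs⇒< {n} ij∈ =
  proj₂ (∈-filter⁻ (λ (i , j) → i Fin.<? j) {xs = cartesianProduct (allFin n) (allFin n)} ij∈)

-- Families of exponents as relabeled adjacency relations.

module _ (G : FiniteGraph) (ℓ : Labeling G) where

  place : Permutation′ (order G) → Fin (order G) → Vertex G
  place σ i = Inverse.from ℓ (σ ⟨$⟩ʳ i)

  -- The family of exponents extended to all pairs, free of the minimum and maximum in the action.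
  pulledBack : Permutation′ (order G) → Fin (order G) → Fin (order G) → Bool
  pulledBack σ i j = adjacent G (place σ i) (place σ j)

  -- The action merely sorts the two images, and adjacency is symmetric.
  coefficient-· : ∀ σ i j → coefficient G ℓ (σ · (i , j)) ≡ indicator (pulledBack σ i j)
  coefficient-· σ i j =
    [ (λ ≤ → cong₂ c (Min.x≤y⇒x⊓y≈x O ≤) (Max.x≤y⇒x⊔y≈y O ≤))
    , (λ ≥ → trans (cong₂ c (Min.x≤y⇒y⊓x≈x O ≥) (Max.x≤y⇒y⊔x≈y O ≥))
                   (cong indicator (FiniteGraph.symmetric G _ _)))
    ]′ (Fin.≤-total (σ ⟨$⟩ʳ i) (σ ⟨$⟩ʳ j))
    where
    O = Fin.≤-totalOrder (order G)
    c : Fin (order G) → Fin (order G) → ℕ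
    c x y = coefficient G ℓ (x , y)

  sameFamily⁺ : ∀ {σ τ} → (∀ i j → pulledBack σ i j ≡ pulledBack τ i j) → SameFamily G ℓ σ τ
  sameFamily⁺ {σ} {τ} eq i j _ = trans (coefficient-· σ i j)
    (trans (cong indicator (eq i j)) (sym (coefficient-· τ i j)))

  -- Agreement for `i` below `j` extends by symmetry of adjacency, and to the diagonal by
  -- irreflexivity.
  sameFamily⁻ : ∀ {σ τ} → SameFamily G ℓ σ τ → ∀ i j → pulledBack σ i j ≡ pulledBack τ i j
  sameFamily⁻ {σ} {τ} same i j with Fin.<-cmp i j
  ... | tri< i<j _ _ = indicator-injective
    (trans (sym (coefficient-· σ i j)) (trans (same i j i<j) (coefficient-· τ i j)))
  ... | tri≈ _ refl _ = trans (FiniteGraph.irreflexive G _) (sym (FiniteGraph.irreflexive G _))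
  ... | tri> _ _ j<i = trans (FiniteGraph.symmetric G _ _) (trans
    (indicator-injective
      (trans (sym (coefficient-· σ j i)) (trans (same j i j<i) (coefficient-· τ j i))))
    (FiniteGraph.symmetric G _ _))

-- Labels of `H` and the substituted values.

module _ (H : FiniteGraph) (ℓ : Labeling H) where

  label : Vertex H → ℕ
  label v = suc (toℕ (Inverse.to ℓ v))

  label-injective : ∀ {u v} → label u ≡ label v → u ≡ v
  label-injective = to-injective ℓ ∘ Fin.toℕ-injective ∘ ℕ.suc-injective

  label≤order : ∀ v → label v ≤ order H
  label≤order v = Fin.toℕ<n (Inverse.to ℓ v)

  substitution≤1 : ∀ x → substitution H ℓ x ≤ 1
  substitution≤1 (zero  , _)    = z≤n
  substitution≤1 (suc i , zero) = z≤n
  substitution≤1 (suc i , suc j) with i ℕ.<? j | j ℕ.<? order H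
  ... | yes _ | yes _ = indicator≤1 _
  ... | yes _ | no  _ = z≤n
  ... | no  _ | _     = z≤n

  substitution-label : ∀ {u v} → label u < label v →
                       substitution H ℓ (label u , label v) ≡ indicator (adjacent H u v)
  substitution-label {u} {v} u<v
    with toℕ (Inverse.to ℓ u) ℕ.<? toℕ (Inverse.to ℓ v) | toℕ (Inverse.to ℓ v) ℕ.<? order H
  ... | yes _  | yes _  = cong₂ (λ x y → indicator (adjacent H x y)) (unlabel u _) (unlabel v _)
    where
    unlabel : ∀ w .(l : toℕ (Inverse.to ℓ w) < order H) → Inverse.from ℓ (fromℕ< l) ≡ w
    unlabel w l = trans (cong (Inverse.from ℓ) (Fin.fromℕ<-toℕ _ l)) (Inverse.strictlyInverseʳ ℓ w)
  ... | yes _  | no v≮N = contradiction (Fin.toℕ<n _) v≮N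
  ... | no u≮v | _      = contradiction (ℕ.≤-pred u<v) u≮v

  -- All default cases of the substitution are 0, so a nonzero value can only come from the labels
  -- of two adjacent vertices.
  substitution≢0 : ∀ x y → substitution H ℓ (x , y) ≢ 0 →
                   ∃ λ u → ∃ λ v → x ≡ label u × y ≡ label v × T (adjacent H u v)
  substitution≢0 zero    _    ≢0 = contradiction refl ≢0
  substitution≢0 (suc i) zero ≢0 = contradiction refl ≢0
  substitution≢0 (suc i) (suc j) ≢0 with i ℕ.<? j | j ℕ.<? order H
  ... | no  _   | _       = contradiction refl ≢0
  ... | yes _   | no  _   = contradiction refl ≢0
  ... | yes i<j | yes j<N = _ , _ , label-from (ℕ.<-trans i<j j<N) , label-from j<N , indicator≢0⇒T ≢0
    where
    label-from : ∀ {k} (k<N : k < order H) → suc k ≡ label (Inverse.from ℓ (fromℕ< k<N))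
    label-from k<N = cong suc (sym (trans
      (cong toℕ (Inverse.strictlyInverseˡ ℓ (fromℕ< k<N))) (Fin.toℕ-fromℕ< k<N)))

-- Values of the terms of `𝓜`.

module _ (G : FiniteGraph) (ℓ : Labeling G) (R : List (Permutation′ (order G))) where

  private n = order G

  MonomialIndex : Set
  MonomialIndex = FormalSum.Index (𝓜 G ℓ R)

  _≟-index_ : DecidableEquality MonomialIndex
  _≟-index_ = ×-≡-dec _≟-tuple_ Fin._≟_

  family : MonomialIndex → Fin n → Fin n → Bool
  family (_ , p) = pulledBack G ℓ (lookup R p)

  module _ (b : Variable → ℕ) where

    value : MonomialIndex → ℕ
    value = evaluate b ∘ FormalSum.term (𝓜 G ℓ R)

    value≤1 : (∀ x → b x ≤ 1) → ∀ a → value a ≤ 1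
    value≤1 b≤1 (r , p) = evaluate≤1 (All.map⁺
      (All.universal (λ ij → power≤1 (coefficient G ℓ (lookup R p · ij)) (b≤1 _)) (orderedPairs n)))

    -- A product of natural numbers is nonzero once all factors are, and factors with exponent 0
    -- equal 1.
    value≢0⁺ : ∀ a → (∀ i j → i Fin.< j → T (family a i j) →
                  b (entry (proj₁ a) i , entry (proj₁ a) j) ≢ 0) →
               value a ≢ 0
    value≢0⁺ a@(r , p) b≢0 = evaluate≢0⁺ (All.map⁺ {xs = orderedPairs n} (All.tabulate λ {(i , j)} ij∈ →
      subst (λ e → b (entry r i , entry r j) ^ e ≢ 0) (sym (coefficient-· G ℓ (lookup R p) i j))
        (power≢0⁺ (family a i j) (b≢0 i j (∈-orderedPairs⇒< ij∈)))))

    value≢0⁻ : ∀ a → value a ≢ 0 →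
               ∀ i j → i Fin.< j → T (family a i j) → b (entry (proj₁ a) i , entry (proj₁ a) j) ≢ 0
    value≢0⁻ a@(r , p) ≢0 i j i<j = power≢0⁻ (family a i j)
      (subst (λ e → b (entry r i , entry r j) ^ e ≢ 0) (coefficient-· G ℓ (lookup R p) i j)
        (All.lookup (All.map⁻ {xs = orderedPairs n} (evaluate≢0⁻ ≢0)) (∈-orderedPairs i<j)))

-- The correspondence between monomials and copies of `G`.

module _ (G : FiniteGraph) (noIsolated : NoIsolatedVertex G) (ℓ : Labeling G)
         (R : List (Permutation′ (order G))) (transversal : IsTransversal G ℓ R)
         (H : FiniteGraph) (ℓ′ : Labeling H) where

  private
    n = order G
    b = substitution H ℓ′
    Index = MonomialIndex G ℓ R

  -- The monomial at (r , p) encodes S: the vertices of S carry the labels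
  -- r₁ < ⋯ < rₙ, and its edges are read off the family of the permutation p.
  record _Encodes_ (a : Index) (S : Subgraph (graph H)) : Set where
    private r = proj₁ a
    field
      vertexAt : ∀ i → ∃ λ v → entry r i ≡ label H ℓ′ v × T (vertices S v)
      indexOf  : ∀ v → T (vertices S v) → ∃ λ i → entry r i ≡ label H ℓ′ v
      edge     : ∀ {u v i j} → entry r i ≡ label H ℓ′ u → entry r j ≡ label H ℓ′ v →
                 edges S u v ≡ family G ℓ R a i j

  open _Encodes_

  -- Labels are injective, so the entries determine the vertices. An edge has its endpoints in the
  -- subgraph, so both have positions and the field `edge` decides it.
  encodes-univalent : ∀ {a S S′} → a Encodes S → a Encodes S′ →
    (∀ v → vertices S v ≡ vertices S′ v) × (∀ u v → edges S u v ≡ edges S′ u v)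
  encodes-univalent {a} {S} {S′} e e′ =
    (λ v → T-extensional (vertices⊆ e e′ v) (vertices⊆ e′ e v)) ,
    (λ u v → T-extensional (edges⊆edges e e′ u v) (edges⊆edges e′ e u v))
    where
    vertices⊆ : ∀ {S S′} → a Encodes S → a Encodes S′ → ∀ v → T (vertices S v) → T (vertices S′ v)
    vertices⊆ {S′ = S′} e e′ v v∈S with indexOf e v v∈S
    ... | i , rᵢ≡v with vertexAt e′ i
    ...   | w , rᵢ≡w , w∈S′ =
      subst (T ∘ vertices S′) (label-injective H ℓ′ (trans (sym rᵢ≡w) rᵢ≡v)) w∈S′

    edges⊆edges : ∀ {S S′} → a Encodes S → a Encodes S′ → ∀ u v → T (edges S u v) → T (edges S′ u v)
    edges⊆edges {S} e e′ u v uv∈S with endpoints S uv∈S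
    ... | u∈S , v∈S with indexOf e u u∈S | indexOf e v v∈S
    ...   | i , rᵢ≡u | j , rⱼ≡v = subst T (trans (edge e rᵢ≡u rⱼ≡v) (sym (edge e′ rᵢ≡u rⱼ≡v))) uv∈S

  -- The vertex set determines the set of entries, hence the tuple; the edge set then determines the
  -- family, which the transversal contains only once.
  encodes-injective : ∀ {a a′ S S′} →
    (∀ v → vertices S v ≡ vertices S′ v) × (∀ u v → edges S u v ≡ edges S′ u v) →
    a Encodes S → a′ Encodes S′ → a ≡ a′
  encodes-injective {a} {a′} {S} {S′} (vertices≡ , edges≡) e e′ = ×-≡,≡→≡ (r≡r′ , p≡p′)
    where
    r≡r′ : proj₁ a ≡ proj₁ a′
    r≡r′ = tuple-extensional
      (λ i → let v , rᵢ≡v , v∈S = vertexAt e i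
                 j , r′ⱼ≡v = indexOf e′ v (subst T (vertices≡ v) v∈S)
             in j , trans rᵢ≡v (sym r′ⱼ≡v))
      (λ i → let v , r′ᵢ≡v , v∈S′ = vertexAt e′ i
                 j , rⱼ≡v = indexOf e v (subst T (sym (vertices≡ v)) v∈S′)
             in j , trans r′ᵢ≡v (sym rⱼ≡v))

    family≡ : ∀ i j → family G ℓ R a i j ≡ family G ℓ R a′ i j
    family≡ i j =
      let u , rᵢ≡u , _ = vertexAt e i
          v , rⱼ≡v , _ = vertexAt e j
          r⇒r′ = λ {k w} → subst (λ r → entry r k ≡ label H ℓ′ w) r≡r′
      in trans (sym (edge e rᵢ≡u rⱼ≡v)) (trans (edges≡ u v) (edge e′ (r⇒r′ rᵢ≡u) (r⇒r′ rⱼ≡v)))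

    p≡p′ : proj₂ a ≡ proj₂ a′
    p≡p′ = AllPairs-¬⇒≡ {R = SameFamily G ℓ} (λ same i j i<j → sym (same i j i<j)) (proj₁ transversal)
      (sameFamily⁺ G ℓ {lookup R (proj₂ a)} {lookup R (proj₂ a′)} family≡)

  -- An exponent 1 marks an edge of `S`, hence of `H`, so its variable becomes 1.
  encodes⇒value≢0 : ∀ {a S} → a Encodes S → value G ℓ R b a ≢ 0
  encodes⇒value≢0 {a@(r , p)} {S} e = value≢0⁺ G ℓ R b a b≢0
    where
    b≢0 : ∀ i j → i Fin.< j → T (family G ℓ R a i j) → b (entry r i , entry r j) ≢ 0
    b≢0 i j i<j ij∈G with vertexAt e i | vertexAt e j | entry-mono r i<j
    ... | u , rᵢ≡u , _ | v , rⱼ≡v , _ | rᵢ<rⱼ rewrite rᵢ≡u | rⱼ≡v = subst (_≢ 0)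
      (sym (substitution-label H ℓ′ rᵢ<rⱼ))
      (T⇒indicator≢0 (edges⊆ S (subst T (sym (edge e rᵢ≡u rⱼ≡v)) ij∈G)))

  -- The copy of `G` read off a monomial with nonzero value.

  module _ (a : Index) (value≢0 : value G ℓ R b a ≢ 0) where

    private
      r = proj₁ a
      σ = lookup R (proj₂ a)

    -- A variable with exponent 1 must not become 0. Symmetry handles `j` below `i`, and `G` has no
    -- loops.
    edge-present : ∀ i j → T (family G ℓ R a i j) →
      ∃ λ u → ∃ λ v → entry r i ≡ label H ℓ′ u × entry r j ≡ label H ℓ′ v × T (adjacent H u v)
    edge-present i j ij∈G with Fin.<-cmp i j
    ... | tri< i<j _ _ = substitution≢0 H ℓ′ _ _ (value≢0⁻ G ℓ R b a value≢0 i j i<j ij∈G)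
    ... | tri≈ _ refl _ with () ← subst T (FiniteGraph.irreflexive G _) ij∈G
    ... | tri> _ _ j<i =
      let v , u , rⱼ≡v , rᵢ≡u , vu∈H = substitution≢0 H ℓ′ _ _
            (value≢0⁻ G ℓ R b a value≢0 j i j<i (subst T (FiniteGraph.symmetric G _ _) ij∈G))
      in u , v , rᵢ≡u , rⱼ≡v , subst T (FiniteGraph.symmetric H _ _) vu∈H

    placeOf : Vertex G → Fin n
    placeOf g = σ ⟨$⟩ˡ Inverse.to ℓ g

    place-placeOf : ∀ g → place G ℓ σ (placeOf g) ≡ g
    place-placeOf g = trans (cong (Inverse.from ℓ) (inverseʳ σ)) (Inverse.strictlyInverseʳ ℓ g)

    -- As G has no isolated vertex, every entry of r occurs in a variable
    -- of the monomial, hence is the label of a vertex.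
    labelled : ∀ i → ∃ λ v → entry r i ≡ label H ℓ′ v
    labelled i =
      let g , ig∈G = noIsolated (place G ℓ σ i)
          v , _ , rᵢ≡v , _ = edge-present i (placeOf g)
            (subst (T ∘ adjacent G (place G ℓ σ i)) (sym (place-placeOf g)) ig∈G)
      in v , rᵢ≡v

    private
      -- Search over the finitely many positions gives the Boolean characteristic functions that
      -- `Subgraph` requires.
      vertex? : ∀ v → Dec (∃ λ i → entry r i ≡ label H ℓ′ v)
      vertex? v = Fin.any? λ i → entry r i ℕ.≟ label H ℓ′ v

      edge? : ∀ u v → Dec (∃ λ i → ∃ λ j → entry r i ≡ label H ℓ′ u × entry r j ≡ label H ℓ′ v ×
                                        T (family G ℓ R a i j))
      edge? u v = Fin.any? λ i → Fin.any? λ j →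
        entry r i ℕ.≟ label H ℓ′ u ×-dec entry r j ℕ.≟ label H ℓ′ v ×-dec T? (family G ℓ R a i j)

      swap : ∀ u v → T ⌊ edge? u v ⌋ → T ⌊ edge? v u ⌋
      swap u v uv = let i , j , rᵢ≡u , rⱼ≡v , ij∈G = toWitness {a? = edge? u v} uv in
        fromWitness {a? = edge? v u} (j , i , rⱼ≡v , rᵢ≡u , subst T (FiniteGraph.symmetric G _ _) ij∈G)

    encoded : Subgraph (graph H)
    encoded = record
      { vertices  = λ v → ⌊ vertex? v ⌋
      ; edges     = λ u v → ⌊ edge? u v ⌋
      ; symmetric = λ u v → T-extensional (swap u v) (swap v u)
      ; edges⊆    = λ {u} {v} uv →
          let i , j , rᵢ≡u , rⱼ≡v , ij∈G = toWitness {a? = edge? u v} uv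
              u′ , v′ , rᵢ≡u′ , rⱼ≡v′ , uv∈H = edge-present i j ij∈G
          -- `edge-present` supplies its own vertices; injectivity of labels identifies them with
          -- `u` and `v`.
          in subst T (cong₂ (adjacent H) (label-injective H ℓ′ (trans (sym rᵢ≡u′) rᵢ≡u))
                                         (label-injective H ℓ′ (trans (sym rⱼ≡v′) rⱼ≡v))) uv∈H
      ; endpoints = λ {u} {v} uv →
          let i , j , rᵢ≡u , rⱼ≡v , _ = toWitness {a? = edge? u v} uv
          in fromWitness {a? = vertex? u} (i , rᵢ≡u) , fromWitness {a? = vertex? v} (j , rⱼ≡v)
      }

    encodes : a Encodes encoded
    encodes = record
      { vertexAt = λ i → let v , rᵢ≡v = labelled i in
          v , rᵢ≡v , fromWitness {a? = vertex? v} (i , rᵢ≡v)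
      ; indexOf  = λ v → toWitness {a? = vertex? v}
      ; edge     = λ {u} {v} {i} {j} rᵢ≡u rⱼ≡v → T-extensional
          (λ uv → let i′ , j′ , rᵢ′≡u , rⱼ′≡v , ij∈G = toWitness {a? = edge? u v} uv in
            subst T (cong₂ (family G ℓ R a) (entry-injective r (trans rᵢ′≡u (sym rᵢ≡u)))
                                            (entry-injective r (trans rⱼ′≡v (sym rⱼ≡v)))) ij∈G)
          (λ ij∈G → fromWitness {a? = edge? u v} (i , j , rᵢ≡u , rⱼ≡v , ij∈G))
      }

    -- The vertex labelled by entry `i` goes to `place G ℓ σ i`; preservation of adjacency is then
    -- the field `edge`.
    encoded≅G : toGraph encoded ≅ graph G
    encoded≅G = record
      { bijection = mk↔ₛ′ to from to∘from from∘to
      ; preserves = λ (u , u∈S) (v , v∈S) →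
          edge encodes (proj₂ (indexOf encodes u u∈S)) (proj₂ (indexOf encodes v v∈S))
      }
      where
      to : Graph.Vertex (toGraph encoded) → Vertex G
      to (v , v∈S) = place G ℓ σ (proj₁ (indexOf encodes v v∈S))

      from : Vertex G → Graph.Vertex (toGraph encoded)
      from g = let v , _ , v∈S = vertexAt encodes (placeOf g) in v , v∈S

      to∘from : ∀ g → to (from g) ≡ g
      to∘from g =
        let v , rᵢ≡v , v∈S = vertexAt encodes (placeOf g)
            j , rⱼ≡v = indexOf encodes v v∈S
        in trans (cong (place G ℓ σ) (entry-injective r (trans rⱼ≡v (sym rᵢ≡v)))) (place-placeOf g)

      placeOf-place : ∀ i → placeOf (place G ℓ σ i) ≡ i
      placeOf-place i = trans (cong (σ ⟨$⟩ˡ_) (Inverse.strictlyInverseˡ ℓ _)) (Inverse.strictlyInverseʳ σ i)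

      from∘to : ∀ v → from (to v) ≡ v
      from∘to (v , v∈S) =
        let i , rᵢ≡v = indexOf encodes v v∈S
            w , rⱼ≡w , _ = vertexAt encodes (placeOf (place G ℓ σ i))
        in Σ-≡,≡→≡ (label-injective H ℓ′
             (trans (sym rⱼ≡w) (trans (cong (entry r) (placeOf-place i)) rᵢ≡v)) , T-irrelevant _ _)

  -- Sorting the vertices of `S` by label gives the tuple. Sending sorted positions through the
  -- isomorphism to labels of `G` gives a permutation, whose family is represented in `R`.
  encoding : ∀ (S : Subgraph (graph H)) → toGraph S ≅ graph G → ∃ λ a → a Encodes S
  encoding S iso with sortedEnumeration ℓ′ (vertices S)
  ... | m , enum , mono with ↔⇒≡ (ℓ ↔-∘ (_≅_.bijection iso ↔-∘ enum))
  -- The composite bijection between `Fin m` and `Fin n` forces `m` to be `n`; only then is it a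
  -- permutation.
  ...   | refl = (r , p) , record
    { vertexAt = λ i → let v , v∈S = Inverse.to enum i in v , r-entry i , v∈S
    ; indexOf  = λ v v∈S → Inverse.from enum (v , v∈S) , trans (r-entry _)
        (cong (label H ℓ′ ∘ proj₁) (Inverse.strictlyInverseˡ enum (v , v∈S)))
    ; edge     = λ {u} {v} {i} {j} rᵢ≡u rⱼ≡v → trans
        (cong₂ (edges S) (vertex-entry i rᵢ≡u) (vertex-entry j rⱼ≡v))
        -- `R` need not contain `σ`, only a permutation with the same family.
        (trans (edges-pulledBack i j)
          (sameFamily⁻ G ℓ {σ} {lookup R p} (lookup-index (proj₂ transversal σ)) i j))
    }
    where
    σ : Permutation′ n
    σ = ℓ ↔-∘ (_≅_.bijection iso ↔-∘ enum)

    p = index (proj₂ transversal σ)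

    r = tabulateTuple (λ i → label H ℓ′ (proj₁ (Inverse.to enum i))) (λ _ → s≤s z≤n) (s≤s ∘ mono)

    r-entry : ∀ i → entry r i ≡ label H ℓ′ (proj₁ (Inverse.to enum i))
    r-entry = Vec.lookup∘tabulate _

    vertex-entry : ∀ {v} i → entry r i ≡ label H ℓ′ v → v ≡ proj₁ (Inverse.to enum i)
    vertex-entry i rᵢ≡v = label-injective H ℓ′ (trans (sym rᵢ≡v) (r-entry i))

    edges-pulledBack : ∀ i j → edges S (proj₁ (Inverse.to enum i)) (proj₁ (Inverse.to enum j)) ≡
                               pulledBack G ℓ σ i j
    edges-pulledBack i j = trans (_≅_.preserves iso _ _)
      (sym (cong₂ (adjacent G) (Inverse.strictlyInverseʳ ℓ _) (Inverse.strictlyInverseʳ ℓ _)))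

  -- An instance of `count` for `_Encodes_`. Here `k` may still depend on `ℓ′`.
  evaluation-counts : ∃ λ k →
    (𝓜 G ℓ R at b evaluatesTo k) × HasCardinality (Occurrences (graph G) (graph H)) k
  evaluation-counts = count (_≟-index_ G ℓ R) (Occurrences (graph G) (graph H))
    (value G ℓ R b) (value≤1 G ℓ R b (substitution≤1 H ℓ′))
    -- By `labelled`, a nonzero value forces all entries to be labels, so this list contains the
    -- support.
    (cartesianProduct (boundedTuples (order H) n) (allFin (length R)))
    (λ a@(r , p) value≢0 → ∈-cartesianProduct⁺
      (∈-boundedTuples r λ i → let v , rᵢ≡v = labelled a value≢0 i in
        subst (_≤ order H) (sym rᵢ≡v) (label≤order H ℓ′ v))
      (∈-allFin p))
    (λ a (S , _) → a Encodes S)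
    (λ a value≢0 → (encoded a value≢0 , encoded≅G a value≢0) , encodes a value≢0)
    (λ (S , iso) → let a , e = encoding S iso in a , encodes⇒value≢0 e , e)
    encodes-injective
    encodes-univalent

theorem2p4 : (G : FiniteGraph) → 2 ≤ FiniteGraph.order G → NoIsolatedVertex G →
    (ℓ : Labeling G) (R : List (Permutation′ (FiniteGraph.order G))) → IsTransversal G ℓ R →
    ∃ λ (φ : FiniteGraph → ℕ) →
    ∀ (H : FiniteGraph) →
    (∀ (ℓ′ : Labeling H) → 𝓜 G ℓ R at substitution H ℓ′ evaluatesTo φ H) ×
    HasCardinality (Occurrences (FiniteGraph.graph G) (FiniteGraph.graph H)) (φ H)
-- The value is defined with the labeling that `H` carries. Any other labeling yields a cardinality
-- of the same set of occurrences, hence the same number.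
theorem2p4 G _ noIsolated ℓ R transversal = (λ H → proj₁ (counts H (FiniteGraph.finite H))) , λ H →
  let k , _ , k-occurrences = counts H (FiniteGraph.finite H) in
  (λ ℓ′ → let k′ , evaluates , k′-occurrences = counts H ℓ′ in
     subst (𝓜 G ℓ R at substitution H ℓ′ evaluatesTo_)
       (cardinality-unique {Occurrences (graph G) (graph H)} k′-occurrences k-occurrences) evaluates) ,
  k-occurrences
  where
  counts = evaluation-counts G noIsolated ℓ R transversal
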